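{- For all impartial Conway's games $x,y\in\mathcal I$, $$g(x)=g(y)\iff x\approx y .$$
   Context: Hypergames: work in a universe of possibly non-wellfounded sets (set theory with the Antifoundation Axiom, and the Axiom of Choice). The class $\mathcal H$ of hypergames (also called games) is the carrier of the final coalgebra $(\mathcal H,\mathrm{id})$ of the functor $F(A)=\mathcal P(A)\times\mathcal P(A)$ on the category of classes and functional classes, where $\mathcal P$ is the powerset functor. Thus a hypergame is a pair $x=(X^L,X^R)$ of sets of hypergames; elements of $X^L$, $X^R$ are the Left and Right options of $x$. Positions of $x$ are the hypergames hereditarily reachable from $x$. Impartial Conway's games: a hypergame is impartial if at every position L and R have the same options; an impartial game is represented simply as the set $x=X$ of its options, identified with the hypergame $(X,X)$ (hereditarily). $\mathcal I$ is the class of well-founded impartial games, i.e. the carrier of the initial algebra of $\mathcal P$ (well-founded sets). Grundy function: for a set $S$ of ordinals, $\mathrm{mex}(S)$ is the least ordinal not in $S$. $g:\mathcal I\to\mathrm{Ord}$ is the Grundy-Sprague function, the unique function with $g(x)=\mathrm{mex}\{g(y)\mid y\in x\}$. Sum (on hypergames, defined coinductively): $x+y=(\{x^L+y\mid x^L\in X^L\}\cup\{x+y^L\mid y^L\in Y^L\},\ \{x^R+y\mid x^R\in X^R\}\cup\{x+y^R\mid y^R\in Y^R\})$. Plays: L (Left) and R (Right) move alternately; either may start. Player I is the one who starts, player II the other one; LI means L acting as player I, and similarly LII, RI, RII. A play on $x$ is a (possibly empty) finite or infinite sequence $x_1^{K_1}x_2^{K_2}\cdots$ with $K_i\in\{L,R\}$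 and $K_{i+1}\neq K_i$, such that, with $x_0=x$ and $x_i=(X_i^L,X_i^R)$, one has $x_{i+1}\in X_i^{K_{i+1}}$ for all $i\ge 0$. A finite play is winning for L (resp. R) if it ends with a position $y=(Y^L,Y^R)$ where R (resp. L) is next to move but $Y^R=\emptyset$ (resp. $Y^L=\emptyset$); the empty play ends at $x$ with the starting player next to move. Every infinite play is a draw. A play is non-losing for L (resp. R) if it is winning for L (resp. R) or is a draw. Strategies: for P in $\{$LI, LII, RI, RII$\}$ let $\mathrm{FPlay}^P_x$ be the set of finite plays on $x$ in which P has the prescribed role (first or second player) and is next to move (the empty play is included exactly when P is LI or RI). A strategy for P on $x$ is a partial function $f$ from $\mathrm{FPlay}^P_x$ to positions of $x$ such that $f(\pi)=x'$ implies that $\pi x'$ is a play, and $f(\pi)$ is defined whenever some $\pi x'$ is a play. The opponent of LI is RII, and of LII is RI (and conversely). A play $\pi$ is coherent with $f$ if for each proper prefix $\pi'$ of $\pi$ where P is next to move, $f(\pi')=x'$ implies $\pi'x'$ is a prefix of $\pi$. For a strategy $f$ for P and a strategy $f'$ for the opponent, $f*f'$ is the unique maximal play coherent with both. $f$ is non-losing for P if $f*f'$ is non-losing for P (i.e. for L or R accordingly) for every strategy $f'$ of the opponent. A strategy for L is a pair of strategies for LI and LII; for R, for RI and RII; for I, for LI and RI; for II, for LII and RII. Such a pair is non-losing if both components are. Equideterminacy: $x\Updownarrow y$ iff, for each player P in $\{$L, R, I, II$\}$, $x$ has a non-losing strategy for P if and only if $y$ does. Contextual equivalence: additive contexts are $C[\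 ]::=[\ ]\mid C[\ ]+z\mid z+C[\ ]$ with $z$ any hypergame; $x\approx y$ iff $C[x]\Updownarrow C[y]$ for every additive context $C[\ ]$. -}

module Defs where

open import Axiom.ExcludedMiddle using (ExcludedMiddle)
open import Data.Empty using (⊥)
open import Data.Maybe using (Maybe; just; nothing)
open import Data.Maybe.Relation.Binary.Pointwise using (Pointwise)
open import Data.Nat using (ℕ; zero; suc)
open import Data.Product using (Σ; Σ-syntax; ∃; ∃-syntax; _×_; _,_; proj₁; proj₂)
open import Data.Sum using (_⊎_)
open import Data.Unit using (⊤)
open import Function.Bundles using (_⇔_; Func; Surjection)
open import Level using (Lift; lift; lower; 0ℓ) renaming (suc to lsuc)
open import Relation.Binary.Bundles using (Setoid)
open import Relation.Binary.PropositionalEquality using (_≡_)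
open import Relation.Nullary using (¬_; yes; no; contradiction)

------------------------------------------------------------------------
-- The axiom of choice for sets: every surjection has a section.  Sets are
-- setoids with a small carrier, and the section must respect the
-- equalities, so this does not follow from the choice built into Σ-types.

AxiomOfChoice : Set (lsuc (lsuc 0ℓ))
AxiomOfChoice =
  ∀ {A B : Setoid 0ℓ (lsuc 0ℓ)} (p : Surjection A B) →
  Σ[ s ∈ Func B A ] (∀ b → Setoid._≈_ B (Surjection.to p (Func.to s b)) b)

------------------------------------------------------------------------
-- Hypergames

data Side : Set where
  L R : Side

opp : Side → Side
opp L = R
opp R = L

-- Under the antifoundation axiom the elements of the final coalgebra of
-- A ↦ 𝒫 A × 𝒫 A are exactly the small pointed graphs with Left and Right
-- edges (pointed coalgebras), two of them being the same hypergame when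
-- they are bisimilar.  Equality of hypergames is _≃_ throughout.

record Hypergame : Set₁ where
  field
    Node : Set
    Move : Side → Node → Node → Set
    root : Node

open Hypergame public

infix 8 _at_

_at_ : (x : Hypergame) → Node x → Hypergame
x at n = record { Node = Node x ; Move = Move x ; root = n }

infix 4 _≃_

record _≃_ (x y : Hypergame) : Set₁ where
  field
    Rel   : Node x → Node y → Set
    roots : Rel (root x) (root y)
    forth : ∀ {K m n m′} → Rel m n → Move x K m m′ →
            ∃[ n′ ] (Move y K n n′ × Rel m′ n′)
    back  : ∀ {K m n n′} → Rel m n → Move y K n n′ →
            ∃[ m′ ] (Move x K m m′ × Rel m′ n′)

-- x′ ∈[ K ] x : x′ is an element of the set of K-options of x.

infix 4 _∈[_]_

_∈[_]_ : Hypergame → Side → Hypergame → Set₁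
x′ ∈[ K ] x = ∃[ n ] (Move x K (root x) n × x′ ≃ x at n)

-- The node (m , n) stands for the sum of x at m and y at n.

data SumMove (x y : Hypergame) (K : Side) :
             Node x × Node y → Node x × Node y → Set where
  moveˡ : ∀ {m m′ n} → Move x K m m′ → SumMove x y K (m , n) (m′ , n)
  moveʳ : ∀ {m n n′} → Move y K n n′ → SumMove x y K (m , n) (m , n′)

infixl 6 _+_

_+_ : Hypergame → Hypergame → Hypergame
x + y = record
  { Node = Node x × Node y
  ; Move = SumMove x y
  ; root = root x , root y
  }

------------------------------------------------------------------------
-- Plays

-- A play started by S determines the marks of its moves: they alternate,
-- beginning with S.  For the empty play S records who is to move first.

data FinPlay (x : Hypergame) (S : Side) : Set₁
next : ∀ {x S} → FinPlay x S → Side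
last : ∀ {x S} → FinPlay x S → Hypergame

data FinPlay x S where
  ε    : FinPlay x S
  snoc : (π : FinPlay x S) (z : Hypergame) → z ∈[ next π ] last π →
         FinPlay x S

next {S = S} ε    = S
next (snoc π z _) = opp (next π)

last {x = x} ε    = x
last (snoc π z _) = z

turn : Side → ℕ → Side
turn S zero    = S
turn S (suc n) = opp (turn S n)

position : Hypergame → (ℕ → Hypergame) → ℕ → Hypergame
position x moves zero    = x
position x moves (suc n) = moves n

-- moves n is the (n+1)-st element of the play.

record InfPlay (x : Hypergame) (S : Side) : Set₁ where
  field
    moves : ℕ → Hypergame
    valid : ∀ n → moves n ∈[ turn S n ] position x moves n

open InfPlay public

data Play (x : Hypergame) (S : Side) : Set₁ where
  fin : FinPlay x S → Play x S
  inf : InfPlay x S → Play x S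

-- Equality of finite plays as sequences of hypergames.

infix 4 _≋_ _⊏_ _≺_ _≼_ _⊑_

data _≋_ {x : Hypergame} {S : Side} : FinPlay x S → FinPlay x S → Set₁ where
  ε    : ε ≋ ε
  snoc : ∀ {π ρ z w p q} → π ≋ ρ → z ≃ w → snoc π z p ≋ snoc ρ w q

data _⊏_ {x : Hypergame} {S : Side} : FinPlay x S → FinPlay x S → Set₁ where
  here  : ∀ {π ρ z p} → π ≋ ρ → π ⊏ snoc ρ z p
  there : ∀ {π ρ z p} → π ⊏ ρ → π ⊏ snoc ρ z p

-- IsPrefix π n σ : π consists of the first n elements of σ.

data IsPrefix {x : Hypergame} {S : Side} :
              FinPlay x S → ℕ → InfPlay x S → Set₁ where
  ε    : ∀ {σ} → IsPrefix ε zero σ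
  snoc : ∀ {π n σ z p} → IsPrefix π n σ → z ≃ moves σ n →
         IsPrefix (snoc π z p) (suc n) σ

-- Proper prefixes and prefixes of arbitrary plays.

_≺_ : ∀ {x S} → FinPlay x S → Play x S → Set₁
π ≺ fin ρ = π ⊏ ρ
π ≺ inf σ = ∃[ n ] IsPrefix π n σ

_≼_ : ∀ {x S} → FinPlay x S → Play x S → Set₁
π ≼ fin ρ = (π ≋ ρ) ⊎ (π ⊏ ρ)
π ≼ inf σ = ∃[ n ] IsPrefix π n σ

_⊑_ : ∀ {x S} → Play x S → Play x S → Set₁
ρ ⊑ ρ′ = ∀ π → π ≼ ρ → π ≼ ρ′

Winning : ∀ {x S} → Side → Play x S → Set₁
Winning A (fin π) = next π ≡ opp A × ¬ (∃[ z ] z ∈[ next π ] last π)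
Winning A (inf σ) = Lift _ ⊥

Draw : ∀ {x S} → Play x S → Set
Draw (fin π) = ⊥
Draw (inf σ) = ⊤

NonLosingPlay : ∀ {x S} → Side → Play x S → Set₁
NonLosingPlay A ρ = Winning A ρ ⊎ Draw ρ

------------------------------------------------------------------------
-- Strategies

record Role : Set where
  constructor role
  field
    starter : Side
    side    : Side

open Role public

LI LII RI RII : Role
LI  = role L L
LII = role R L
RI  = role R R
RII = role L R

opponent : Role → Role
opponent (role S A) = role S (opp A)

-- Partiality is expressed by Maybe; congruent says that a strategy is a
-- function of the play as a sequence of hypergames.

record Strategy (x : Hypergame) (P : Role) : Set₁ where
  field
    choose    : (π : FinPlay x (starter P)) → next π ≡ side P → Maybe Hypergame
    legal     : ∀ {π t z} → choose π t ≡ just z → z ∈[ next π ] last π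
    defined   : ∀ {π t} → ∃[ z ] z ∈[ next π ] last π →
                ∃[ z ] choose π t ≡ just z
    congruent : ∀ {π ρ t u} → π ≋ ρ → Pointwise _≃_ (choose π t) (choose ρ u)

open Strategy public

Coherent : ∀ {x P} → Strategy x P → Play x (starter P) → Set₁
Coherent {P = P} f ρ =
  ∀ π (t : next π ≡ side P) {z} → π ≺ ρ →
  (e : choose f π t ≡ just z) → snoc π z (legal f e) ≼ ρ

-- IsProduct f f′ ρ : ρ is the play f * f′, the maximal play coherent with
-- both f and f′.  It is unique only up to _≋_, hence a relation.

IsProduct : ∀ {x P} → Strategy x P → Strategy x (opponent P) →
            Play x (starter P) → Set₁
IsProduct {x} {P} f f′ ρ =
  Coherent f ρ × Coherent f′ ρ ×
  (∀ (ρ′ : Play x (starter P)) →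
     Coherent f ρ′ → Coherent f′ ρ′ → ρ ⊑ ρ′ → ρ′ ⊑ ρ)

NonLosing : ∀ {x P} → Strategy x P → Set₁
NonLosing {x} {P} f =
  ∀ (f′ : Strategy x (opponent P)) ρ → IsProduct f f′ ρ →
  NonLosingPlay (side P) ρ

data Player : Set where
  L R I II : Player

roles : Player → Role × Role
roles L  = LI  , LII
roles R  = RI  , RII
roles I  = LI  , RI
roles II = LII , RII

StrategyFor : Hypergame → Player → Set₁
StrategyFor x P = Strategy x (proj₁ (roles P)) × Strategy x (proj₂ (roles P))

HasNonLosingStrategy : Hypergame → Player → Set₁
HasNonLosingStrategy x P =
  Σ[ f ∈ StrategyFor x P ] (NonLosing (proj₁ f) × NonLosing (proj₂ f))

------------------------------------------------------------------------
-- Equideterminacy and contextual equivalence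

infix 4 _⇕_ _≈_

_⇕_ : Hypergame → Hypergame → Set₁
x ⇕ y = ∀ P → HasNonLosingStrategy x P ⇔ HasNonLosingStrategy y P

data Context : Set₁ where
  □    : Context
  _+ˡ_ : Context → Hypergame → Context
  _+ʳ_ : Hypergame → Context → Context

_[_] : Context → Hypergame → Hypergame
□        [ x ] = x
(C +ˡ z) [ x ] = C [ x ] + z
(z +ʳ C) [ x ] = z + C [ x ]

_≈_ : Hypergame → Hypergame → Set₁
x ≈ y = ∀ C → C [ x ] ⇕ C [ y ]

------------------------------------------------------------------------
-- Impartial games

-- node A f is the set { f i ∣ i ∈ A }.

data Impartial : Set₁ where
  node : (A : Set) → (A → Impartial) → Impartial

-- The graph of node A f: nothing is the root, and just (i , p) is the node p
-- of the graph of f i.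

Pos : Impartial → Set
Pos (node A f) = Maybe (Σ[ i ∈ A ] Pos (f i))

top : ∀ x → Pos x
top (node A f) = nothing

data Edge {A : Set} (f : A → Impartial)
          (E : ∀ i → Pos (f i) → Pos (f i) → Set) :
          Pos (node A f) → Pos (node A f) → Set where
  enter  : ∀ i → Edge f E nothing (just (i , top (f i)))
  inside : ∀ {i p q} → E i p q → Edge f E (just (i , p)) (just (i , q))

ImpartialMove : ∀ x → Pos x → Pos x → Set
ImpartialMove (node A f) = Edge f (λ i → ImpartialMove (f i))

⌜_⌝ : Impartial → Hypergame
⌜ x ⌝ = record
  { Node = Pos x
  ; Move = λ _ → ImpartialMove x
  ; root = top x
  }

------------------------------------------------------------------------
-- Ordinals and the Grundy function

-- sup⁺ A s is the least ordinal strictly above all s i.  Every tree denotes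
-- an ordinal in this way, and equality of ordinals is _≈ₒ_.

data Ord : Set₁ where
  sup⁺ : (A : Set) → (A → Ord) → Ord

infix 4 _≤ₒ_ _<ₒ_ _≈ₒ_

_≤ₒ_ _<ₒ_ : Ord → Ord → Set
sup⁺ A s ≤ₒ β  = ∀ i → s i <ₒ β
α <ₒ sup⁺ B t  = ∃[ j ] α ≤ₒ t j

_≈ₒ_ : Ord → Ord → Set
α ≈ₒ β = α ≤ₒ β × β ≤ₒ α

≤ₒ-refl : ∀ α → α ≤ₒ α
≤ₒ-refl (sup⁺ A s) i = i , ≤ₒ-refl (s i)

≤ₒ-trans  : ∀ α β γ → α ≤ₒ β → β ≤ₒ γ → α ≤ₒ γ
<ₒ-≤ₒ-trans : ∀ α β γ → α <ₒ β → β ≤ₒ γ → α <ₒ γ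
≤ₒ-trans (sup⁺ A s) β γ p q i = <ₒ-≤ₒ-trans (s i) β γ (p i) q
<ₒ-≤ₒ-trans α (sup⁺ B t) (sup⁺ C u) (j , p) q =
  proj₁ (q j) , ≤ₒ-trans α (t j) (u (proj₁ (q j))) p (proj₂ (q j))

<ₒ-irrefl : ∀ α → ¬ (α <ₒ α)
<ₒ-irrefl (sup⁺ A s) (i , p) = <ₒ-irrefl (s i) (p i)

-- The set S is the family s, and IsMex s α says that α is the least ordinal
-- not in S.

infix 4 _∈ₒ_

_∈ₒ_ : {A : Set} → Ord → (A → Ord) → Set
α ∈ₒ s = ∃[ i ] s i ≈ₒ α

IsMex : {A : Set} → (A → Ord) → Ord → Set₁
IsMex s α = ¬ (α ∈ₒ s) × (∀ β → ¬ (β ∈ₒ s) → α ≤ₒ β)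

module _ (em : ExcludedMiddle (lsuc 0ℓ)) where

  ≮ₒ⇒≥ₒ : ∀ α β → ¬ (α <ₒ β) → β ≤ₒ α
  ≮ₒ⇒≥ₒ α (sup⁺ B t) α≮β j with em {Lift _ (t j <ₒ α)}
  ... | yes (lift tj<α) = tj<α
  ... | no  tj≮α        =
    contradiction (j , ≮ₒ⇒≥ₒ (t j) α (λ p → tj≮α (lift p))) α≮β

  least : (P : Ord → Set) → ∀ α β → P β → β ≤ₒ α →
          Σ[ μ ∈ Ord ] (P μ × (∀ γ → P γ → μ ≤ₒ γ))
  least P (sup⁺ A s) β Pβ β≤α with em {Σ[ γ ∈ Ord ] (P γ × γ <ₒ sup⁺ A s)}
  ... | yes (γ , Pγ , i , γ≤si) = least P (s i) γ Pγ γ≤si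
  ... | no  none = β , Pβ , λ γ Pγ →
    ≤ₒ-trans β (sup⁺ A s) γ β≤α
      (≮ₒ⇒≥ₒ γ (sup⁺ A s) (λ γ<α → none (γ , Pγ , γ<α)))

  mex-exists : {A : Set} (s : A → Ord) → Σ[ α ∈ Ord ] IsMex s α
  mex-exists {A} s =
    least (λ α → ¬ (α ∈ₒ s)) (sup⁺ A s) (sup⁺ A s)
      (λ { (i , _ , sup≤si) → <ₒ-irrefl (s i) (sup≤si i) })
      (≤ₒ-refl (sup⁺ A s))

  mex : {A : Set} → (A → Ord) → Ord
  mex s = proj₁ (mex-exists s)

  grundy : Impartial → Ord
  grundy (node A f) = mex (λ i → grundy (f i))

{-# OPTIONS --safe #-}

-- Classically, A has a non-losing strategy when S starts exactly if some set
-- of positions contains the initial one, is preserved by all moves of A's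
-- opponent, and offers A a move inside it whenever A is to move.  Such sets
-- are invariant under bisimilarity, and C[x] is bisimilar to x + Z for a Z
-- depending on C only.  If g(x) = g(y), a safe set for x + Z gives one for
-- y + Z: a move to a smaller Grundy value in one of the two impartial games is
-- answered in the other one, and a move to a larger value is reverted in the
-- same game.  Conversely y + y is non-losing for II, hence so is x + y, and this
-- forces g(x) = g(y), because otherwise I moves to equal values.

module Submission where

open import Axiom.ExcludedMiddle using (ExcludedMiddle)
open import Data.Bool using (Bool; T)
open import Data.Empty using (⊥)
open import Data.Maybe as Maybe using (Maybe; just; nothing)
open import Data.Maybe.Properties using (just-injective)
open import Data.Maybe.Relation.Binary.Pointwise using (Pointwise; just)
import Data.Maybe.Relation.Binary.Pointwise as Pointwise
open import Data.Nat using (ℕ; zero; suc; _<_)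
open import Data.Nat.Properties using (<-irrefl; n<1+n; m<n⇒m<1+n)
open import Data.Product using (Σ-syntax; ∃; ∃-syntax; _×_; _,_; proj₁; proj₂; map₂)
open import Data.Sum using (_⊎_; inj₁; inj₂; [_,_]′)
open import Data.Unit using (⊤; tt)
open import Function.Bundles using (_⇔_; mk⇔; module Equivalence; Func; Surjection)
open import Induction.WellFounded using (Acc; acc; WellFounded)
open import Level using (Lift; lift; lower; 0ℓ) renaming (suc to lsuc)
open import Relation.Binary.Bundles using (Setoid)
open import Relation.Binary.PropositionalEquality
  using (_≡_; _≢_; refl; sym; trans; cong; subst; subst₂)
open import Relation.Nullary using (¬_; Dec; yes; no; contradiction)
open import Relation.Nullary.Decidable
  using (isYes; isYes≗does; does-⇔; toWitness; fromWitness)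
open import Defs

private
  variable
    x y z w : Hypergame
    K S A : Side

opp-involutive : ∀ K → opp (opp K) ≡ K
opp-involutive L = refl
opp-involutive R = refl

opp-irrefl : ∀ K → opp K ≢ K
opp-irrefl L ()
opp-irrefl R ()

same⊎opp : ∀ K A → K ≡ A ⊎ K ≡ opp A
same⊎opp L L = inj₁ refl
same⊎opp L R = inj₂ refl
same⊎opp R L = inj₂ refl
same⊎opp R R = inj₁ refl

-- Bisimilarity

≃-refl : x ≃ x
≃-refl = record
  { Rel   = _≡_
  ; roots = refl
  ; forth = λ { refl mv → _ , mv , refl }
  ; back  = λ { refl mv → _ , mv , refl }
  }

≃-sym : x ≃ y → y ≃ x
≃-sym r = record
  { Rel   = λ n m → Rel m n
  ; roots = roots
  ; forth = back
  ; back  = forth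
  } where open _≃_ r

≃-trans : x ≃ y → y ≃ z → x ≃ z
≃-trans r s = record
  { Rel   = λ m k → ∃[ n ] (r.Rel m n × s.Rel n k)
  ; roots = _ , r.roots , s.roots
  ; forth = λ { (_ , p , q) mv → let _ , mv′ , p′ = r.forth p mv
                                     _ , mv″ , q′ = s.forth q mv′
                                 in _ , mv″ , _ , p′ , q′ }
  ; back  = λ { (_ , p , q) mv → let _ , mv′ , q′ = s.back q mv
                                     _ , mv″ , p′ = r.back p mv′
                                 in _ , mv″ , _ , p′ , q′ }
  } where module r = _≃_ r
          module s = _≃_ s

≃-at : (r : x ≃ y) → ∀ {m n} → _≃_.Rel r m n → x at m ≃ y at n
≃-at r p = record { Rel = Rel ; roots = p ; forth = forth ; back = back }
  where open _≃_ r

∈-resp-≃ : z ≃ w → x ≃ y → z ∈[ K ] x → w ∈[ K ] y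
∈-resp-≃ z≃w x≃y (_ , mv , z≃) =
  let _ , mv′ , r = _≃_.forth x≃y (_≃_.roots x≃y) mv
  in _ , mv′ , ≃-trans (≃-sym z≃w) (≃-trans z≃ (≃-at x≃y r))

∈-respʳ-≡ : ∀ {K K′} → K ≡ K′ → x ≃ y → z ∈[ K ] x → z ∈[ K′ ] y
∈-respʳ-≡ refl = ∈-resp-≃ ≃-refl

-- Finite plays

module _ {x : Hypergame} {S : Side} where

  private
    variable
      π ρ σ τ : FinPlay x S

  ≋-refl : π ≋ π
  ≋-refl {ε}          = ε
  ≋-refl {snoc π z p} = snoc ≋-refl ≃-refl

  ≋-sym : π ≋ ρ → ρ ≋ π
  ≋-sym ε          = ε
  ≋-sym (snoc e r) = snoc (≋-sym e) (≃-sym r)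

  ≋-trans : π ≋ ρ → ρ ≋ σ → π ≋ σ
  ≋-trans ε          ε          = ε
  ≋-trans (snoc e r) (snoc f s) = snoc (≋-trans e f) (≃-trans r s)

  ≋-next : π ≋ ρ → next π ≡ next ρ
  ≋-next ε          = refl
  ≋-next (snoc e _) = cong opp (≋-next e)

  ≋-last : π ≋ ρ → last π ≃ last ρ
  ≋-last ε          = ≃-refl
  ≋-last (snoc _ r) = r

  ≋-∈ : π ≋ ρ → z ≃ w → z ∈[ next π ] last π → w ∈[ next ρ ] last ρ
  ≋-∈ e r p = ∈-respʳ-≡ (≋-next e) (≋-last e) (∈-resp-≃ r ≃-refl p)

  ≋-⊏ : π ≋ ρ → ρ ⊏ σ → π ⊏ σ
  ≋-⊏ e (here f)  = here (≋-trans e f)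
  ≋-⊏ e (there q) = there (≋-⊏ e q)

  ⊏-≋ : π ⊏ ρ → ρ ≋ σ → π ⊏ σ
  ⊏-≋ (here e)  (snoc f _) = here (≋-trans e f)
  ⊏-≋ (there q) (snoc f _) = there (⊏-≋ q f)

  ≋-≼ : π ≋ ρ → ρ ≼ fin σ → π ≼ fin σ
  ≋-≼ e (inj₁ f) = inj₁ (≋-trans e f)
  ≋-≼ e (inj₂ q) = inj₂ (≋-⊏ e q)

  ≼-≋ : π ≼ fin ρ → ρ ≋ σ → π ≼ fin σ
  ≼-≋ (inj₁ e) f = inj₁ (≋-trans e f)
  ≼-≋ (inj₂ q) f = inj₂ (⊏-≋ q f)

  ≼⇒⊏-snoc : ∀ {p} → π ≼ fin ρ → π ⊏ snoc ρ z p
  ≼⇒⊏-snoc (inj₁ e) = here e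
  ≼⇒⊏-snoc (inj₂ q) = there q

  length : FinPlay x S → ℕ
  length ε            = zero
  length (snoc π _ _) = suc (length π)

  ≋-length : π ≋ ρ → length π ≡ length ρ
  ≋-length ε          = refl
  ≋-length (snoc e _) = cong suc (≋-length e)

  ⊏-length : π ⊏ ρ → length π < length ρ
  ⊏-length (here e) rewrite ≋-length e = n<1+n _
  ⊏-length (there q) = m<n⇒m<1+n (⊏-length q)

  -- Equal plays have equal `length` and a proper prefix has a smaller one, so a cycle of prefixes
  -- contradicts irreflexivity of `_<_`.
  ⊏-asym-≼ : π ⊏ ρ → ¬ (ρ ≼ fin π)
  ⊏-asym-≼ q (inj₁ e) = <-irrefl (sym (≋-length e)) (⊏-length q)
  ⊏-asym-≼ q (inj₂ r) = <-irrefl refl (⊏-length (⊏-trans q r))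
    where
    ⊏-trans : π ⊏ ρ → ρ ⊏ σ → π ⊏ σ
    ⊏-trans q (here e)  = there (⊏-≋ q e)
    ⊏-trans q (there r) = there (⊏-trans q r)

  ⊏-continuation : π ⊏ ρ → ∃[ w ] Σ[ p ∈ w ∈[ next π ] last π ] snoc π w p ≼ fin ρ
  ⊏-continuation (here {p = p} e) = _ , ≋-∈ (≋-sym e) ≃-refl p , inj₁ (snoc e ≃-refl)
  ⊏-continuation (there q) = let w , p , s = ⊏-continuation q in w , p , inj₂ (≼⇒⊏-snoc s)

  IsPrefix-next : ∀ {n σ} → IsPrefix π n σ → next π ≡ turn S n
  IsPrefix-next ε          = refl
  IsPrefix-next (snoc i _) = cong opp (IsPrefix-next i)

  IsPrefix-last : ∀ {n σ} → IsPrefix π n σ → last π ≃ position x (moves σ) n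
  IsPrefix-last ε          = ≃-refl
  IsPrefix-last (snoc _ r) = r

  -- Hypergames form a large type but nodes a small one; this lets the axiom of choice act on
  -- `Node x` when moves are selected.
  last-node : (π : FinPlay x S) → ∃[ n ] last π ≃ x at n
  last-node ε = root x , ≃-refl
  last-node (snoc π z (n , mv , z≃)) =
    let _ , r         = last-node π
        n′ , _ , r′ = _≃_.forth r (_≃_.roots r) mv
    in n′ , ≃-trans z≃ (≃-at r r′)

  -- An extension `ρ′` either equals π or continues it by a legal move, and `stuck` rules out the
  -- latter.
  stuck-maximal : ¬ (∃[ z ] z ∈[ next π ] last π) → ∀ ρ′ → fin π ⊑ ρ′ → ρ′ ⊑ fin π
  stuck-maximal {π} stuck (fin ρ) π⊑ρ σ σ≼ρ with π⊑ρ π (inj₁ ≋-refl)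
  ... | inj₁ e = ≼-≋ σ≼ρ (≋-sym e)
  ... | inj₂ q = let w , p , _ = ⊏-continuation q in contradiction (w , p) stuck
  stuck-maximal {π} stuck (inf ρ) π⊑ρ with π⊑ρ π (inj₁ ≋-refl)
  ... | n , i = contradiction
    (_ , ∈-respʳ-≡ (sym (IsPrefix-next i)) (≃-sym (IsPrefix-last i)) (valid ρ n)) stuck

-- Coherence

just-related : ∀ {m m′} → Pointwise _≃_ m m′ → m ≡ just z → m′ ≡ just w → z ≃ w
just-related (just r) refl refl = r

module _ {x : Hypergame} {P : Role} (f : Strategy x P) where

  coherent-ε : Coherent f (fin ε)
  coherent-ε _ _ ()

  coherent-other : ∀ {π z p} → next π ≢ side P → Coherent f (fin π) →
                   Coherent f (fin (snoc π z p))
  coherent-other nx≢ c σ t (here e)  _  = contradiction (trans (sym (≋-next e)) t) nx≢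
  coherent-other nx≢ c σ t (there q) eq = inj₂ (≼⇒⊏-snoc (c σ t q eq))

  coherent-own : ∀ {π t z p} → choose f π t ≡ just z → Coherent f (fin π) →
                 Coherent f (fin (snoc π z p))
  coherent-own {t = t} eq′ c σ u (here e) eq =
    inj₁ (snoc e (just-related (congruent f {t = u} {u = t} e) eq eq′))
  coherent-own eq′ c σ u (there q) eq = inj₂ (≼⇒⊏-snoc (c σ u q eq))

  -- A prescribed continuation of a proper prefix of π could leave π only by being all of
  -- `snoc π z p`, and then that prefix would equal π.
  coherent-init : ∀ {π z p} → Coherent f (fin (snoc π z p)) → Coherent f (fin π)
  coherent-init c σ t q eq with c σ t (there q) eq
  ... | inj₁ (snoc e _) = contradiction (inj₁ (≋-sym e)) (⊏-asym-≼ q)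
  ... | inj₂ (here e)   = inj₁ e
  ... | inj₂ (there r)  = inj₂ r

  coherent-last : ∀ {π z w p} → Coherent f (fin (snoc π z p)) →
                  (t : next π ≡ side P) → choose f π t ≡ just w → w ≃ z
  coherent-last c t eq with c _ t (here ≋-refl) eq
  ... | inj₁ (snoc _ r) = r
  ... | inj₂ (here e)   = contradiction (inj₁ e) (⊏-asym-≼ (here ≋-refl))
  ... | inj₂ (there q)  = contradiction (inj₂ q) (⊏-asym-≼ (here ≋-refl))

-- Safe sets

-- A postfixed point rather than an inductive winning region: draws are non-losing, so no progress
-- is demanded. The side says who is to move; `Good` lands in `Set₁` because sets built from
-- strategies quantify over plays.
record Safe (x : Hypergame) (S A : Side) : Set₂ where
  field
    Good  : Side → Node x → Set₁
    start : Good S (root x)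
    own   : ∀ {n} → Good A n → ∃[ n′ ] (Move x A n n′ × Good (opp A) n′)
    other : ∀ {n n′} → Good (opp A) n → Move x (opp A) n n′ → Good A n′

Safe-resp-≃ : x ≃ y → Safe x S A → Safe y S A
Safe-resp-≃ r W = record
  { Good  = λ K n → ∃[ m ] (Lift (lsuc 0ℓ) (Rel m n) × Good K m)
  ; start = _ , lift roots , start
  ; own   = λ { (_ , lift p , g) → let _ , mv , g′ = own g
                                       _ , mv′ , p′ = forth p mv
                                   in _ , mv′ , _ , lift p′ , g′ }
  ; other = λ { (_ , lift p , g) mv → let _ , mv′ , p′ = back p mv
                                      in _ , lift p′ , other g mv′ }
  } where open _≃_ r
          open Safe W

-- Contexts

-- The hole is filled with the game without options, which is neutral for the sum.
contextGame : Context → Hypergame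
contextGame □        = record { Node = ⊤ ; Move = λ _ _ _ → ⊥ ; root = tt }
contextGame (C +ˡ z) = contextGame C + z
contextGame (z +ʳ C) = z + contextGame C

-- By induction on the context: the step for `C +ˡ z` is associativity of the sum, and the step for
-- `z +ʳ C` adds commutativity.
plug-≃ : ∀ C → C [ x ] ≃ x + contextGame C
plug-≃ □ = record
  { Rel   = λ m n → m ≡ proj₁ n
  ; roots = refl
  ; forth = λ { refl mv → _ , moveˡ mv , refl }
  ; back  = λ { refl (moveˡ mv) → _ , mv , refl }
  }
plug-≃ (C +ˡ z) = record
  { Rel   = λ { (c , k) (n , d , k′) → Rel c (n , d) × k ≡ k′ }
  ; roots = roots , refl
  ; forth = λ { (r , refl) (moveˡ mv) → case-forth (forth r mv)
              ; (r , refl) (moveʳ mv) → _ , moveʳ (moveʳ mv) , r , refl }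
  ; back  = λ { (r , refl) (moveˡ mv) →
                  let _ , mv′ , r′ = back r (moveˡ mv) in _ , moveˡ mv′ , r′ , refl
              ; (r , refl) (moveʳ (moveˡ mv)) →
                  let _ , mv′ , r′ = back r (moveʳ mv) in _ , moveˡ mv′ , r′ , refl
              ; (r , refl) (moveʳ (moveʳ mv)) → _ , moveʳ mv , r , refl }
  }
  where
  open _≃_ (plug-≃ C)
  case-forth : ∀ {K c n d k} →
    ∃[ n′ ] (SumMove _ (contextGame C) K (n , d) n′ × Rel c n′) →
    ∃[ n′ ] (SumMove _ (contextGame C + z) K (n , d , k) n′ ×
             (Rel c (proj₁ n′ , proj₁ (proj₂ n′)) × k ≡ proj₂ (proj₂ n′)))
  case-forth (_ , moveˡ mv , r) = _ , moveˡ mv , r , refl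
  case-forth (_ , moveʳ mv , r) = _ , moveʳ (moveˡ mv) , r , refl
plug-≃ (z +ʳ C) = record
  { Rel   = λ { (k , c) (n , k′ , d) → Rel c (n , d) × k ≡ k′ }
  ; roots = roots , refl
  ; forth = λ { (r , refl) (moveʳ mv) → case-forth (forth r mv)
              ; (r , refl) (moveˡ mv) → _ , moveʳ (moveˡ mv) , r , refl }
  ; back  = λ { (r , refl) (moveˡ mv) →
                  let _ , mv′ , r′ = back r (moveˡ mv) in _ , moveʳ mv′ , r′ , refl
              ; (r , refl) (moveʳ (moveʳ mv)) →
                  let _ , mv′ , r′ = back r (moveʳ mv) in _ , moveʳ mv′ , r′ , refl
              ; (r , refl) (moveʳ (moveˡ mv)) → _ , moveˡ mv , r , refl }
  }
  where
  open _≃_ (plug-≃ C)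
  case-forth : ∀ {K c n d k} →
    ∃[ n′ ] (SumMove _ (contextGame C) K (n , d) n′ × Rel c n′) →
    ∃[ n′ ] (SumMove _ (z + contextGame C) K (n , k , d) n′ ×
             (Rel c (proj₁ n′ , proj₂ (proj₂ n′)) × k ≡ proj₁ (proj₂ n′)))
  case-forth (_ , moveˡ mv , r) = _ , moveˡ mv , r , refl
  case-forth (_ , moveʳ mv , r) = _ , moveʳ (moveʳ mv) , r , refl

-- Extensional choice and the strategies built from it

module _ (em : ExcludedMiddle (lsuc 0ℓ)) (ac : AxiomOfChoice) where

  -- A choice function for the nonempty subsets of N that depends only on the
  -- extension of the subset.

  module Choice (N : Set) where

    -- Characteristic functions into `Bool` keep the carrier in `Set`, as `AxiomOfChoice` requires;
    -- excluded middle turns any predicate into one.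
    Inhabited : Set
    Inhabited = Σ[ U ∈ (N → Bool) ] ∃[ n ] T (U n)

    Subsets Pointed : Setoid 0ℓ (lsuc 0ℓ)
    Subsets = record
      { Carrier = Inhabited
      ; _≈_ = λ (U , _) (V , _) → Lift _ (∀ n → U n ≡ V n)
      ; isEquivalence = record
        { refl  = lift λ _ → refl
        ; sym   = λ (lift e) → lift λ n → sym (e n)
        ; trans = λ (lift e) (lift f) → lift λ n → trans (e n) (f n)
        }
      }
    Pointed = record
      { Carrier = Inhabited
      ; _≈_ = λ (U , m , _) (V , n , _) → Lift _ (m ≡ n × (∀ n → U n ≡ V n))
      ; isEquivalence = record
        { refl  = lift (refl , λ _ → refl)
        ; sym   = λ (lift (d , e)) → lift (sym d , λ n → sym (e n))
        ; trans = λ (lift (d , e)) (lift (d′ , f)) →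
                    lift (trans d d′ , λ n → trans (e n) (f n))
        }
      }

    -- The identity on carriers; only the equality becomes coarser. A section that respects
    -- equalities must pick the same point for extensionally equal subsets.
    forget : Surjection Pointed Subsets
    forget = record
      { to         = λ U → U
      ; cong       = λ (lift (_ , e)) → lift e
      ; surjective = λ U → U , λ (lift (_ , e)) → lift e
      }

    section : Func Subsets Pointed
    section = proj₁ (ac forget)

    extension : (P : N → Set₁) → ∃ P → Inhabited
    extension P (n , p) = (λ n → isYes (em {P n})) , n , fromWitness p

    pick : (P : N → Set₁) → ∃ P → N
    pick P e = proj₁ (proj₂ (Func.to section (extension P e)))

    -- The point lies in the subset returned by the section, and that subset has the same extension
    -- as `P`.
    pick-satisfies : ∀ P e → P (pick P e)
    pick-satisfies P e =
      let _ , n , t = Func.to section (extension P e)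
      in toWitness (subst T (lower (proj₂ (ac forget) (extension P e)) n) t)

    pick-cong : ∀ {P Q} d e → (∀ n → P n ⇔ Q n) → pick P d ≡ pick Q e
    pick-cong {P} {Q} d e P⇔Q = proj₁ (lower (Func.cong section
      {extension P d} {extension Q e} (lift λ n →
        trans (isYes≗does em)
          (trans (does-⇔ (P⇔Q n) em em) (sym (isYes≗does em))))))

    pickIf : (P : N → Set₁) → Dec (∃ P) → Maybe N
    pickIf P (yes e) = just (pick P e)
    pickIf P (no _)  = nothing

    pick? : (N → Set₁) → Maybe N
    pick? P = pickIf P em

    pick?-satisfies : ∀ P {n} → pick? P ≡ just n → P n
    pick?-satisfies P eq with em {∃ P}
    pick?-satisfies P refl | yes e = pick-satisfies P e

    pick?-defined : ∀ P → ∃ P → ∃[ n ] pick? P ≡ just n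
    pick?-defined P e with em {∃ P}
    ... | yes e′ = _ , refl
    ... | no  ¬e = contradiction e ¬e

    pick?-cong : ∀ P Q → (∀ n → P n ⇔ Q n) → pick? P ≡ pick? Q
    pick?-cong P Q P⇔Q with em {∃ P} | em {∃ Q}
    ... | yes d | yes e = cong just (pick-cong d e P⇔Q)
    ... | no _  | no _  = refl
    ... | yes d | no ¬e = contradiction (map₂ (Equivalence.to (P⇔Q _)) d) ¬e
    ... | no ¬d | yes e = contradiction (map₂ (Equivalence.from (P⇔Q _)) e) ¬d

  -- One construction serves both the opponent who replays a given play and the player who stays in
  -- a safe set: take a move satisfying `Pref` if there is one, otherwise any legal move.
  module Prefer {x : Hypergame} {S : Side} (A : Side)
    (Pref : FinPlay x S → Hypergame → Set₁)
    (Pref-cong : ∀ {π ρ z w} → π ≋ ρ → z ≃ w → Pref π z → Pref ρ w) where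

    open Choice (Node x)

    Preferable : FinPlay x S → Set₁
    Preferable π = ∃[ z ] (z ∈[ next π ] last π × Pref π z)

    Candidate : FinPlay x S → Node x → Set₁
    Candidate π n =
      x at n ∈[ next π ] last π × (Pref π (x at n) ⊎ ¬ Preferable π)

    legal-node : ∀ π {z} → z ∈[ next π ] last π →
                 ∃[ n ] (z ≃ x at n × x at n ∈[ next π ] last π)
    legal-node π {z} p =
      let n , r = last-node {x} {S} (snoc π z p)
      in n , r , ∈-resp-≃ r (≃-refl {last π}) p

    candidate : ∀ π {z} → z ∈[ next π ] last π → ∃ (Candidate π)
    candidate π p with em {Preferable π}
    ... | yes (_ , q , g) = let n , r , q′ = legal-node π q
                            in n , q′ , inj₁ (Pref-cong (≋-refl {π = π}) r g)
    ... | no none = let n , _ , p′ = legal-node π p in n , p′ , inj₂ none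

    Candidate-cong : ∀ {π ρ n} → π ≋ ρ → Candidate π n → Candidate ρ n
    Candidate-cong e (p , inj₁ g) = ≋-∈ e ≃-refl p , inj₁ (Pref-cong e ≃-refl g)
    Candidate-cong e (p , inj₂ none) = ≋-∈ e ≃-refl p , inj₂ λ (z , q , g) →
      none (z , ≋-∈ (≋-sym e) ≃-refl q , Pref-cong (≋-sym e) ≃-refl g)

    preferred : FinPlay x S → Maybe Hypergame
    preferred π = Maybe.map (x at_) (pick? (Candidate π))

    preferred-candidate : ∀ {π z} → preferred π ≡ just z →
                          ∃[ n ] (x at n ≡ z × Candidate π n)
    preferred-candidate {π} eq with pick? (Candidate π) in eq′
    ... | just n = n , just-injective eq , pick?-satisfies _ eq′

    strategy : Strategy x (role S A)
    strategy = record
      { choose    = λ π _ → preferred π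
      ; legal     = λ {π} eq → preferred-legal {π} (preferred-candidate {π} eq)
      ; defined   = λ {π} (z , p) → let n , eq = pick?-defined (Candidate π) (candidate π p)
                                in x at n , cong (Maybe.map (x at_)) eq
      -- Equal plays have the same candidates, so the extensional choice returns the same node.
      ; congruent = λ e → Pointwise.reflexive (λ { refl → ≃-refl })
          (cong (Maybe.map (x at_)) (pick?-cong _ _ λ n →
            mk⇔ (Candidate-cong e) (Candidate-cong (≋-sym e))))
      }
      where
      preferred-legal : ∀ {π z} → ∃[ n ] (x at n ≡ z × Candidate π n) →
                        z ∈[ next π ] last π
      preferred-legal (_ , refl , p , _) = p

    preferred-Pref : ∀ {π z} → preferred π ≡ just z → Preferable π → Pref π z
    preferred-Pref {π} eq pref with preferred-candidate {π} eq
    ... | _ , refl , _ , inj₁ g    = g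
    ... | _ , refl , _ , inj₂ none = contradiction pref none

  -- An opponent who replays `π₀` is coherent with it; this is how a play coherent with a given
  -- strategy is realised as a product.
  module Following {x : Hypergame} {S : Side} (A : Side) (π₀ : FinPlay x S) where

    Continues : FinPlay x S → Hypergame → Set₁
    Continues π z = Σ[ p ∈ z ∈[ next π ] last π ] snoc π z p ≼ fin π₀

    Continues-cong : ∀ {π ρ z w} → π ≋ ρ → z ≃ w → Continues π z → Continues ρ w
    Continues-cong e r (p , q) = ≋-∈ e r p , ≋-≼ (snoc (≋-sym e) (≃-sym r)) q

    open Prefer A Continues Continues-cong public

    coherent-strategy : Coherent strategy (fin π₀)
    coherent-strategy π t {z} q eq =
      let w , p , s = ⊏-continuation q
          _ , s′    = preferred-Pref {π} eq (w , p , p , s)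
      in ≋-≼ (snoc ≋-refl ≃-refl) s′

  -- Non-losing strategies and safe sets

  nonLosing⇒safe : (f : Strategy x (role S A)) → NonLosing f → Safe x S A
  nonLosing⇒safe {x} {S} {A} f nl = record
    { Good  = Good
    ; start = ε , coherent-ε f , refl , ≃-refl
    ; own   = own
    ; other = λ { {n} {n′} (π , c , nx , r) mv →
        snoc π (x at n′) (∈-respʳ-≡ (sym nx) (≃-sym r) (n′ , mv , ≃-refl)) ,
        coherent-other f (λ t → opp-irrefl A (trans (sym nx) t)) c ,
        trans (cong opp nx) (opp-involutive A) , ≃-refl }
    }
    where
    -- Positions reached while obeying `f`: all moves of the opponent and the answers of `f` stay
    -- among them.
    Good : Side → Node x → Set₁
    Good K n = Σ[ π ∈ FinPlay x S ]
      (Coherent f (fin π) × next π ≡ K × last π ≃ x at n)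

    own : ∀ {n} → Good A n → ∃[ n′ ] (Move x A n n′ × Good (opp A) n′)
    own (π , c , nx , r) with em {∃[ z ] z ∈[ next π ] last π}
    ... | yes more =
      let z , eq       = defined f {t = nx} more
          p            = legal f eq
          n′ , mv , r′ = ∈-respʳ-≡ nx r p
      in n′ , mv , snoc π z p , coherent-own f eq c , cong opp nx , r′
    -- Here π is the product of `f` with the opponent who replays it, and it ends with `A` to move,
    -- so `f` would lose.
    ... | no stuck =
      let open Following (opp A) π
      in [ (λ (nx′ , _) → contradiction (trans (sym nx′) nx) (opp-irrefl A)) , (λ ()) ]′
         (nl strategy (fin π) (c , coherent-strategy , λ ρ _ _ → stuck-maximal stuck ρ))

  -- The strategy always moves into the safe set. An infinite product is a draw; a finite one is
  -- maximal, so it ends without a move, and the safe set never leaves `A` without one.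
  safe⇒nonLosing : Safe x S A → Σ[ f ∈ Strategy x (role S A) ] NonLosing f
  safe⇒nonLosing {x} {S} {A} W = strategy , nonLosing
    where
    open Safe W

    Kept : FinPlay x S → Hypergame → Set₁
    Kept _ z = ∃[ n ] (z ≃ x at n × Good (opp A) n)

    Kept-cong : ∀ {π ρ z w} → π ≋ ρ → z ≃ w → Kept π z → Kept ρ w
    Kept-cong _ r (n , s , g) = n , ≃-trans (≃-sym r) s , g

    open Prefer A Kept Kept-cong

    Invariant : FinPlay x S → Set₁
    Invariant π = ∃[ n ] (last π ≃ x at n × Good (next π) n)

    own-preferable : ∀ π → next π ≡ A → Invariant π → Preferable π
    own-preferable π nx (n , r , g) =
      let n′ , mv , g′ = own (subst (λ K → Good K n) nx g)
      in x at n′ , ∈-respʳ-≡ (sym nx) (≃-sym r) (n′ , mv , ≃-refl) , n′ , ≃-refl , g′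

    invariant : ∀ π → Coherent strategy (fin π) → Invariant π
    invariant ε c = _ , ≃-refl , start
    invariant (snoc π z p) c with invariant π (coherent-init strategy c) | same⊎opp (next π) A
    ... | inv | inj₁ nx =
      -- Coherence identifies `z` with the move the strategy chose, which keeps to the safe set.
      let _ , eq    = defined strategy {π} {nx} (z , p)
          n , r , g = preferred-Pref {π} eq (own-preferable π nx inv)
      in n , ≃-trans (≃-sym (coherent-last strategy c nx eq)) r ,
         subst (λ K → Good (opp K) n) (sym nx) g
    ... | n , r , g | inj₂ nx =
      let n′ , mv , r′ = ∈-respʳ-≡ nx r p
      in n′ , r′ , subst (λ K → Good K n′) (sym (trans (cong opp nx) (opp-involutive A)))
                     (other (subst (λ K → Good K n) nx g) mv)

    nonLosing : NonLosing strategy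
    nonLosing f′ (inf _) _ = inj₂ tt
    nonLosing f′ (fin π) (c , c′ , maximal) = inj₁ (next≡ (same⊎opp (next π) A) , stuck)
      where
      not-extendable : ∀ {z p} → Coherent strategy (fin (snoc π z p)) →
                       ¬ Coherent f′ (fin (snoc π z p))
      not-extendable d d′ = ⊏-asym-≼ (here ≋-refl)
        (maximal (fin (snoc π _ _)) d d′ (λ σ q → inj₂ (≼⇒⊏-snoc q)) _ (inj₁ ≋-refl))

      -- Whichever side is to move, its strategy would prescribe a move prolonging the product,
      -- against maximality.
      stuck : ¬ (∃[ z ] z ∈[ next π ] last π)
      stuck more with same⊎opp (next π) A
      ... | inj₁ nx =
        let _ , eq = defined strategy {π} {nx} more
        in not-extendable {p = legal strategy {π} {nx} eq}
             (coherent-own strategy {t = nx} eq c)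
             (coherent-other f′ (λ t → opp-irrefl A (trans (sym t) nx)) c′)
      ... | inj₂ nx =
        let _ , eq = defined f′ {t = nx} more
        in not-extendable {p = legal f′ eq}
             (coherent-other strategy (λ t → opp-irrefl A (trans (sym nx) t)) c)
             (coherent-own f′ eq c′)

      next≡ : next π ≡ A ⊎ next π ≡ opp A → next π ≡ opp A
      next≡ (inj₂ nx) = nx
      next≡ (inj₁ nx) =
        let z , p , _ = own-preferable π nx (invariant π c) in contradiction (z , p) stuck

  Safe-⇕ : (∀ S A → Safe x S A → Safe y S A) → (∀ S A → Safe y S A → Safe x S A) → x ⇕ y
  Safe-⇕ to from P = mk⇔ (transport to) (transport from)
    where
    transport : ∀ {x y} → (∀ S A → Safe x S A → Safe y S A) →
                HasNonLosingStrategy x P → HasNonLosingStrategy y P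
    transport h ((f₁ , f₂) , n₁ , n₂) =
      let g₁ , m₁ = safe⇒nonLosing (h _ _ (nonLosing⇒safe f₁ n₁))
          g₂ , m₂ = safe⇒nonLosing (h _ _ (nonLosing⇒safe f₂ n₂))
      in (g₁ , g₂) , m₁ , m₂

-- Subgames and Grundy values

infix 4 _⊲_

_⊲_ : Impartial → Impartial → Set₁
y ⊲ node A f = ∃[ i ] f i ≡ y

⊲-wellFounded : WellFounded _⊲_
⊲-wellFounded (node A f) = acc λ { (i , refl) → ⊲-wellFounded (f i) }

subgame : ∀ x → Pos x → Impartial
subgame (node A f) nothing        = node A f
subgame (node A f) (just (i , p)) = subgame (f i) p

subgame-top : ∀ x → subgame x (top x) ≡ x
subgame-top (node A f) = refl

move⇒⊲ : ∀ x {p q} → ImpartialMove x p q → subgame x q ⊲ subgame x p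
move⇒⊲ (node A f) (enter i)         = i , sym (subgame-top (f i))
move⇒⊲ (node A f) (inside {i = i} mv) = move⇒⊲ (f i) mv

⊲⇒move : ∀ x p {y} → y ⊲ subgame x p → ∃[ q ] (ImpartialMove x p q × subgame x q ≡ y)
⊲⇒move (node A f) nothing        (i , refl) = _ , enter i , subgame-top (f i)
⊲⇒move (node A f) (just (i , p)) y⊲ =
  let q , mv , eq = ⊲⇒move (f i) p y⊲ in just (i , q) , inside mv , eq

≈ₒ-sym : ∀ α β → α ≈ₒ β → β ≈ₒ α
≈ₒ-sym _ _ (p , q) = q , p

≈ₒ-trans : ∀ α β γ → α ≈ₒ β → β ≈ₒ γ → α ≈ₒ γ
≈ₒ-trans α β γ (p , q) (p′ , q′) = ≤ₒ-trans α β γ p p′ , ≤ₒ-trans γ β α q′ q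

module Grundy (em : ExcludedMiddle (lsuc 0ℓ)) where

  <ₒ⊎≈ₒ⊎>ₒ : ∀ α β → α <ₒ β ⊎ α ≈ₒ β ⊎ β <ₒ α
  <ₒ⊎≈ₒ⊎>ₒ α β with em {Lift _ (α <ₒ β)} | em {Lift _ (β <ₒ α)}
  ... | yes (lift p) | _            = inj₁ p
  ... | no  _        | yes (lift q) = inj₂ (inj₂ q)
  ... | no  ¬p       | no  ¬q       = inj₂ (inj₁
    (≮ₒ⇒≥ₒ em β α (λ q → ¬q (lift q)) , ≮ₒ⇒≥ₒ em α β (λ p → ¬p (lift p))))

  grundy-option : ∀ {x y} → y ⊲ x → ¬ (grundy em y ≈ₒ grundy em x)
  grundy-option {node A f} (i , refl) e =
    proj₁ (proj₂ (mex-exists em (λ i → grundy em (f i)))) (i , e)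

  -- If no option had value `α`, minimality of the mex would put the mex at or below `α`.
  grundy-below : ∀ {α} x → α <ₒ grundy em x → ∃[ y ] (y ⊲ x × grundy em y ≈ₒ α)
  grundy-below {α} (node A f) α<g
    with em {Lift _ (α ∈ₒ λ i → grundy em (f i))}
  ... | yes (lift (i , e)) = f i , (i , refl) , e
  ... | no  none = contradiction
    (<ₒ-≤ₒ-trans α _ α α<g
      (proj₂ (proj₂ (mex-exists em (λ i → grundy em (f i)))) α (λ m → none (lift m))))
    (<ₒ-irrefl α)

  value : ∀ x → Pos x → Ord
  value x p = grundy em (subgame x p)

  value-top : ∀ x → value x (top x) ≡ grundy em x
  value-top x = cong (grundy em) (subgame-top x)

  value-move : ∀ x {p q} → ImpartialMove x p q → ¬ (value x q ≈ₒ value x p)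
  value-move x mv = grundy-option (move⇒⊲ x mv)

  value-below : ∀ x p {α} → α <ₒ value x p →
                ∃[ q ] (ImpartialMove x p q × value x q ≈ₒ α)
  value-below x p α<v with grundy-below (subgame x p) α<v
  ... | y , y⊲ , e with ⊲⇒move x p y⊲
  ... | q , mv , refl = q , mv , e

  -- Replacing a summand by one of equal Grundy value

  module Transfer (x y : Impartial) (Z : Hypergame) {S A : Side}
    (W : Safe (⌜ x ⌝ + Z) S A) where

    open Safe W

    Matched : Side → Pos y × Node Z → Set₁
    Matched K (q , z) = ∃[ p ] (value x p ≈ₒ value y q × Good K (p , z))

    -- The opponent has just moved up in `y` and `A` is to undo it. The imagined play on `x` and `Z`
    -- stands still meanwhile, with the opponent to move.
    Revertible : Pos y × Node Z → Set₁
    Revertible (q , z) = ∃[ q′ ] (ImpartialMove y q q′ × Matched (opp A) (q′ , z))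

    Good′ : Side → Pos y × Node Z → Set₁
    Good′ K n = Matched K n ⊎ (K ≡ A × Revertible n)

    MatchedMove : Pos y × Node Z → Set₁
    MatchedMove n = ∃[ n′ ] (SumMove ⌜ y ⌝ Z A n n′ × Matched (opp A) n′)

    -- A move up in x is imagined to be reverted, which leaves A to move at a
    -- smaller position of x.

    respond : ∀ {p q z} → Acc _⊲_ (subgame x p) → value x p ≈ₒ value y q →
              Good A (p , z) → MatchedMove (q , z)
    reverted : ∀ {p p′ q z} → Acc _⊲_ (subgame x p′) → value x p ≈ₒ value y q →
               value x p <ₒ value x p′ → Good (opp A) (p′ , z) → MatchedMove (q , z)

    respond {p} {q} {z} (acc rec) e g with own g
    ... | _ , moveʳ mv , g′ = _ , moveʳ mv , p , e , g′
    ... | (p′ , _) , moveˡ mv , g′ with <ₒ⊎≈ₒ⊎>ₒ (value x p′) (value x p)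
    ...   | inj₂ (inj₁ e′) = contradiction e′ (value-move x mv)
    -- The recursion descends in `x`, which is well founded; `Z` stays at `z` and may admit infinite
    -- plays.
    ...   | inj₂ (inj₂ up) = reverted {p} {p′} {q} (rec (move⇒⊲ x mv)) e up g′
    ...   | inj₁ down =
      -- The drop can be matched in `y`, as every ordinal below a Grundy value is the value of some
      -- option.
      let q′ , mv′ , e′ = value-below y q
            (<ₒ-≤ₒ-trans (value x p′) (value x p) (value y q) down (proj₁ e))
      in (q′ , z) , moveˡ mv′ , p′ , ≈ₒ-sym (value y q′) (value x p′) e′ , g′

    reverted {p} {p′} {q} {z} (acc rec) e up g =
      let p″ , mv , e′ = value-below x p′ up
      in respond {p″} {q} (rec (move⇒⊲ x mv))
           (≈ₒ-trans (value x p″) (value x p) (value y q) e′ e)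
           (other g (moveˡ {n = z} mv))

    transferred-own : ∀ {n} → Good′ A n →
                      ∃[ n′ ] (SumMove ⌜ y ⌝ Z A n n′ × Good′ (opp A) n′)
    transferred-own {q , z} (inj₁ (p , e , g)) =
      let n′ , mv , m = respond {p} {q} (⊲-wellFounded _) e g in n′ , mv , inj₁ m
    transferred-own {q , z} (inj₂ (_ , q′ , mv , m)) = (q′ , z) , moveˡ mv , inj₁ m

    transferred-other : ∀ {n n′} → Good′ (opp A) n → SumMove ⌜ y ⌝ Z (opp A) n n′ →
                        Good′ A n′
    transferred-other (inj₂ (eq , _)) _ = contradiction eq (opp-irrefl A)
    transferred-other (inj₁ (p , e , g)) (moveʳ mv) = inj₁ (p , e , other g (moveʳ mv))
    transferred-other {q , z} {q′ , _} (inj₁ (p , e , g)) (moveˡ mv)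
      with <ₒ⊎≈ₒ⊎>ₒ (value y q′) (value y q)
    ... | inj₂ (inj₁ e′) = contradiction e′ (value-move y mv)
    ... | inj₁ down =
      -- The opponent's move down in `y` is mirrored by an imagined move of the opponent in `x`,
      -- which `other` keeps safe.
      let p′ , mv′ , e′ = value-below x p
            (<ₒ-≤ₒ-trans (value y q′) (value y q) (value x p) down (proj₂ e))
      in inj₁ (p′ , e′ , other g (moveˡ mv′))
    ... | inj₂ (inj₂ up) =
      let q″ , mv′ , e′ = value-below y q′ up
      in inj₂ (refl , q″ , mv′ , p ,
               ≈ₒ-trans (value x p) (value y q) (value y q″) e
                 (≈ₒ-sym (value y q″) (value y q) e′) , g)

    transferred : grundy em x ≈ₒ grundy em y → Safe (⌜ y ⌝ + Z) S A
    transferred e = record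
      { Good  = Good′
      ; start = inj₁ (top x ,
          subst₂ _≈ₒ_ (sym (value-top x)) (sym (value-top y)) e , start)
      ; own   = transferred-own
      ; other = transferred-other
      }

  -- Second-player play on sums of two impartial games

  copycat : ∀ y A → Safe (⌜ y ⌝ + ⌜ y ⌝) (opp A) A
  copycat y A = record
    -- With the opponent to move the components coincide; with `A` to move one of them is a single
    -- move ahead, and impartiality lets `A` copy that move in the other.
    { Good  = λ K n → (K ≡ opp A × Balanced n) ⊎ (K ≡ A × Balanceable n)
    ; start = inj₁ (refl , lift refl)
    ; own   = own
    ; other = λ { (inj₂ (eq , _)) _ → contradiction eq (opp-irrefl A)
                ; (inj₁ (_ , lift refl)) (moveˡ mv) → inj₂ (refl , lift (inj₂ mv))
                ; (inj₁ (_ , lift refl)) (moveʳ mv) → inj₂ (refl , lift (inj₁ mv)) }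
    }
    where
    Balanced Balanceable : Pos y × Pos y → Set₁
    Balanced (p , q) = Lift _ (p ≡ q)
    Balanceable (p , q) = Lift _ (ImpartialMove y p q ⊎ ImpartialMove y q p)

    own : ∀ {n} → (A ≡ opp A × Balanced n) ⊎ (A ≡ A × Balanceable n) → ∃[ n′ ]
      (SumMove ⌜ y ⌝ ⌜ y ⌝ A n n′ × ((opp A ≡ opp A × Balanced n′) ⊎ (opp A ≡ A × Balanceable n′)))
    own (inj₁ (eq , _)) = contradiction (sym eq) (opp-irrefl A)
    own (inj₂ (_ , lift (inj₁ mv))) = _ , moveˡ mv , inj₁ (refl , lift refl)
    own (inj₂ (_ , lift (inj₂ mv))) = _ , moveʳ mv , inj₁ (refl , lift refl)

  module Separation (x y : Impartial) (W : Safe (⌜ x ⌝ + ⌜ y ⌝) L R) where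

    open Safe W

    -- If the values differed, `L` could lower the larger one to the smaller, leaving `R` at equal
    -- values. The mutual induction descends in the two well-founded games.
    equal-values : ∀ {p q} → Acc _⊲_ (subgame x p) → Acc _⊲_ (subgame y q) →
                   Good L (p , q) → value x p ≈ₒ value y q
    -- No option has the value of its position, so any move destroys equality of the values; yet the
    -- safe move of `R` must lead to equal values.
    unequal-values : ∀ {p q} → Acc _⊲_ (subgame x p) → Acc _⊲_ (subgame y q) →
                     Good R (p , q) → ¬ (value x p ≈ₒ value y q)

    equal-values {p} {q} ap@(acc rec) aq@(acc rec′) g
      with <ₒ⊎≈ₒ⊎>ₒ (value x p) (value y q)
    ... | inj₂ (inj₁ e) = e
    ... | inj₁ p<q =
      let q′ , mv , e = value-below y q p<q
      in contradiction (≈ₒ-sym (value y q′) (value x p) e)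
           (unequal-values {p} {q′} ap (rec′ (move⇒⊲ y mv)) (other g (moveʳ mv)))
    ... | inj₂ (inj₂ q<p) =
      let p′ , mv , e = value-below x p q<p
      in contradiction e
           (unequal-values {p′} {q} (rec (move⇒⊲ x mv)) aq (other g (moveˡ mv)))

    unequal-values {p} {q} ap@(acc rec) aq@(acc rec′) g e with own g
    ... | (p′ , _) , moveˡ mv , g′ = value-move x mv
      (≈ₒ-trans (value x p′) (value y q) (value x p)
        (equal-values {p′} {q} (rec (move⇒⊲ x mv)) aq g′)
        (≈ₒ-sym (value x p) (value y q) e))
    ... | (_ , q′) , moveʳ mv , g′ = value-move y mv
      (≈ₒ-trans (value y q′) (value x p) (value y q)
        (≈ₒ-sym (value x p) (value y q′)
          (equal-values {p} {q′} ap (rec′ (move⇒⊲ y mv)) g′))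
        e)

    grundy-equal : grundy em x ≈ₒ grundy em y
    grundy-equal = subst₂ _≈ₒ_ (value-top x) (value-top y)
      (equal-values {top x} {top y} (⊲-wellFounded _) (⊲-wellFounded _) start)

theorem5p9 : (em : ExcludedMiddle (lsuc 0ℓ)) → AxiomOfChoice →
    ∀ (x y : Impartial) →
    (grundy em x ≈ₒ grundy em y) ⇔ (⌜ x ⌝ ≈ ⌜ y ⌝)
theorem5p9 em ac x y = mk⇔
  (λ e C → Safe-⇕ em ac
    (λ _ _ → replace C e)
    (λ _ _ → replace C (≈ₒ-sym (grundy em x) (grundy em y) e)))
  -- The component taken is the one for `RII`, where `L` starts, as `Separation` expects.
  (λ x≈y → let (_ , f) , _ , nl = secondPlayer x≈y
            in Separation.grundy-equal x y (nonLosing⇒safe em ac f nl))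
  where
  open Grundy em
  secondPlayer : ⌜ x ⌝ ≈ ⌜ y ⌝ → HasNonLosingStrategy (⌜ x ⌝ + ⌜ y ⌝) II
  secondPlayer x≈y =
    let f , n = safe⇒nonLosing em ac (copycat y L)
        g , m = safe⇒nonLosing em ac (copycat y R)
    -- This context turns `x` into x + y and `y` into y + y, where II can copy.
    in Equivalence.from (x≈y (□ +ˡ ⌜ y ⌝) II) ((f , g) , n , m)

  replace : ∀ {x y S A} C → grundy em x ≈ₒ grundy em y →
            Safe (C [ ⌜ x ⌝ ]) S A → Safe (C [ ⌜ y ⌝ ]) S A
  replace {x} {y} C e W = Safe-resp-≃ (≃-sym (plug-≃ C))
    (Transfer.transferred x y (contextGame C) (Safe-resp-≃ (plug-≃ C) W) e)
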